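{- There is an absolute constant $c>0$ such that $r(P_n^{2}, P_n^{2}) < c\, n^{19.487}$ for all integers $n>1$.
   Context: For integers $\ell\ge 1$ and $n\ge 1$, the $\ell$th power $P_n^{\ell}$ of the ordered path is the ordered graph with vertices $v_1<v_2<\cdots<v_n$ and edge set $\{v_iv_j : 1\le |i-j|\le \ell\}$. A copy of an ordered graph on $v_1<\cdots<v_n$ in a 2-coloring of the edges of the complete graph on $[N]=\{1,\dots,N\}$ is given by vertices $x_1<\cdots<x_n$ in $[N]$ such that $x_ix_j$ is an edge of the copy whenever $v_iv_j$ is an edge; it is monochromatic red (blue) if all these edges are red (blue). The ordered Ramsey number $r(P_s^{\ell}, P_n^{\ell})$ is the minimum $N$ such that every red/blue coloring of $\binom{[N]}{2}$ contains a red copy of $P_s^{\ell}$ or a blue copy of $P_n^{\ell}$. -}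

module Defs where

open import Data.Nat using (ℕ; _≤_; _<_; _∸_)
open import Data.Fin using (Fin; toℕ)
open import Data.Bool using (Bool; true; false)
open import Data.Product using (Σ; _×_)
open import Data.Sum using (_⊎_)
open import Relation.Binary.PropositionalEquality using (_≡_)
open import Relation.Nullary using (¬_)

-- A red/blue colouring of the edges of the complete graph on [N] = Fin N.
-- The colour of the edge {a,b} with a < b is χ a b (values with a ≥ b are
-- irrelevant). true = red, false = blue.
Coloring : ℕ → Set
Coloring N = Fin N → Fin N → Bool

red blue : Bool
red = true
blue = false

StrictlyIncreasing : ∀ {n N} → (Fin n → Fin N) → Set
StrictlyIncreasing {n} x = ∀ (i j : Fin n) → toℕ i < toℕ j → toℕ (x i) < toℕ (x j)

MonoCopy : (ℓ n N : ℕ) → Coloring N → Bool → Set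
MonoCopy ℓ n N χ c =
  Σ (Fin n → Fin N) λ x →
    StrictlyIncreasing x ×
    (∀ (i j : Fin n) → toℕ i < toℕ j → toℕ j ∸ toℕ i ≤ ℓ → χ (x i) (x j) ≡ c)

Arrows : (ℓ s n N : ℕ) → Set
Arrows ℓ s n N = (χ : Coloring N) → MonoCopy ℓ s N χ red ⊎ MonoCopy ℓ n N χ blue

IsOrderedRamseyNumber : (ℓ s n r : ℕ) → Set
IsOrderedRamseyNumber ℓ s n r = Arrows ℓ s n r × (∀ m → m < r → ¬ Arrows ℓ s n m)

-- Suppose no monochromatic copy of P²_{k+2} with k = width α exists, and give each
-- edge ab the largest k such that a copy of P²_{k+2} in the colour of ab starts with
-- a, b. On a monochromatic triangle x < y < z the label of xy exceeds that of yz.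
-- Split the range of labels of each colour at a midpoint t. The right neighbours of v
-- joined to v in colour c with label < t span c-edges with labels < t - 1 only, and the
-- left neighbours joined to v in colour c with label ≥ t span c-edges with labels
-- ≥ t + 1 only, so each of these four classes (two per colour) has a window of half
-- the width and, by induction, at most D elements. Every edge puts one of its
-- endpoints in a class of the other, so for some v these sum to at least (N - 1) / 2,
-- whence N ≤ 8 D + 1. Iterating gives N ≤ 9^(2α), which is O(n^(2 log₂ 9)).
module Submission where

open import Data.Bool using (Bool; true; false)
open import Data.Bool.Properties using () renaming (_≟_ to _≟ᵇ_)
open import Data.Fin using (Fin; zero; suc; toℕ; inject≤; combine; remQuot; finToFun; funToFin)
  renaming (_<_ to _<ᶠ_; _<?_ to _<ᶠ?_)
open import Data.Fin.Properties
  using (any?; all?; toℕ-inject≤; remQuot-combine; finToFun-funToFin)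
open import Data.Fin.Subset using (Subset)
open import Data.Fin.Subset.Properties using (anySubset?)
open import Data.List using (List; []; _∷_; length; map; filter; allFin)
open import Data.List.Membership.Propositional using (_∈_)
open import Data.List.Membership.Propositional.Properties using (∈-filter⁻)
open import Data.List.Properties using (length-tabulate)
open import Data.List.Relation.Binary.Subset.Propositional using (_⊆_)
open import Data.List.Relation.Binary.Subset.Propositional.Properties using (filter-⊆)
open import Data.List.Relation.Unary.All using (All; []; _∷_)
open import Data.List.Relation.Unary.AllPairs using (AllPairs; []; _∷_)
import Data.List.Relation.Unary.AllPairs as AllPairs
import Data.List.Relation.Unary.AllPairs.Properties as AllPairs
open import Data.List.Relation.Unary.Any using (here; there)
open import Data.Nat using (ℕ; zero; suc; _+_; _*_; _∸_; _^_; _≤_; _<_; z≤n; s≤s; _≤?_; _<?_)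
open import Data.Nat.ListAction using (sum)
open import Data.Nat.Properties
open import Data.Nat.Tactic.RingSolver using (solve-∀)
open import Data.Product using (Σ; ∃; _×_; _,_; proj₁; proj₂; uncurry)
open import Data.Sum using (_⊎_; inj₁; inj₂)
import Data.Sum as Sum
open import Data.Unit using (⊤; tt)
open import Data.Vec using (lookup; tabulate)
open import Data.Vec.Properties using (lookup∘tabulate)
open import Function using (_∘_; id)
open import Relation.Binary.PropositionalEquality
open import Relation.Binary.Definitions using () renaming (Decidable to Decidable₂)
open import Relation.Nullary using (¬_; Dec; yes; no; contradiction)
open import Relation.Nullary.Decidable using (map′; ¬?; _×-dec_; _⊎-dec_; _→-dec_; decidable-stable)
open import Relation.Unary using (Decidable)
open import Defs

-- Counting in lists and an averaging bound for tournaments.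

count : ∀ {A : Set} {P : A → Set} → Decidable P → List A → ℕ
count P? xs = length (filter P? xs)

module _ {A : Set} {P : A → Set} (P? : Decidable P) where

  count-∷ : ∀ y ys → count P? ys ≤ count P? (y ∷ ys)
  count-∷ y ys with P? y
  ... | yes _ = n≤1+n _
  ... | no  _ = ≤-refl

  count-accept : ∀ {y} ys → P y → count P? ys < count P? (y ∷ ys)
  count-accept {y} ys py with P? y
  ... | yes _  = ≤-refl
  ... | no ¬py = contradiction py ¬py

  count-empty : ∀ xs → (∀ {x} → x ∈ xs → ¬ P x) → count P? xs ≡ 0
  count-empty []       _ = refl
  count-empty (x ∷ xs) f with P? x
  ... | yes px = contradiction px (f (here refl))
  ... | no  _  = count-empty xs (f ∘ there)

count-⊎ : ∀ {A : Set} {P Q : A → Set} (P? : Decidable P) (Q? : Decidable Q) xs →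
          count (λ x → P? x ⊎-dec Q? x) xs ≤ count P? xs + count Q? xs
count-⊎ P? Q? []       = z≤n
count-⊎ P? Q? (x ∷ xs) with P? x | Q? x
... | yes _ | yes _ = s≤s (≤-trans (count-⊎ P? Q? xs) (+-monoʳ-≤ (count P? xs) (n≤1+n _)))
... | yes _ | no  _ = s≤s (count-⊎ P? Q? xs)
... | no  _ | yes _ = ≤-trans (s≤s (count-⊎ P? Q? xs)) (≤-reflexive (sym (+-suc _ _)))
... | no  _ | no  _ = count-⊎ P? Q? xs

module _ {A : Set} {T : A → A → Set} (T? : Decidable₂ T) where

  outdegree : List A → A → ℕ
  outdegree ys x = count (T? x) ys

  outdegreeSum : List A → List A → ℕ
  outdegreeSum xs ys = sum (map (outdegree ys) xs)

  -- Each `y` in `xs` shares an arc with `x`; it is counted at `x` or, once `x` joins the targets,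
  -- at `y`. Keeping `ys` apart lets the induction shrink `xs` alone.
  outdegreeSum-∷ : ∀ x {xs} ys → All (λ y → T x y ⊎ T y x) xs →
    length xs + outdegreeSum xs ys ≤ outdegree xs x + outdegreeSum xs (x ∷ ys)
  outdegreeSum-∷ x ys [] = z≤n
  outdegreeSum-∷ x {y ∷ xs} ys (t ∷ ts) = begin
    suc (length xs + (d + S))  ≡⟨ lemma₁ (length xs) d S ⟩
    suc d + (length xs + S)    ≤⟨ +-monoʳ-≤ (suc d) (outdegreeSum-∷ x ys ts) ⟩
    suc d + (o + S′)           ≡⟨ lemma₂ d o S′ ⟩
    suc (o + d) + S′           ≤⟨ +-monoˡ-≤ S′ (new-edge t) ⟩
    (o′ + d′) + S′             ≡⟨ +-assoc o′ d′ S′ ⟩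
    o′ + (d′ + S′)             ∎
    where
    open ≤-Reasoning
    d  = outdegree ys y
    d′ = outdegree (x ∷ ys) y
    o  = outdegree xs x
    o′ = outdegree (y ∷ xs) x
    S  = outdegreeSum xs ys
    S′ = outdegreeSum xs (x ∷ ys)
    new-edge : T x y ⊎ T y x → suc (o + d) ≤ o′ + d′
    new-edge (inj₁ xy) = +-mono-≤ (count-accept (T? x) xs xy) (count-∷ (T? y) x ys)
    new-edge (inj₂ yx) = ≤-trans (≤-reflexive (sym (+-suc o d)))
      (+-mono-≤ (count-∷ (T? x) y xs) (count-accept (T? y) ys yx))
    lemma₁ : ∀ l d S → suc (l + (d + S)) ≡ suc d + (l + S)
    lemma₁ = solve-∀
    lemma₂ : ∀ d o S → suc d + (o + S) ≡ suc (o + d) + S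
    lemma₂ = solve-∀

  length²≤ : ∀ {xs} → AllPairs (λ x y → T x y ⊎ T y x) xs →
    length xs * length xs ≤ length xs + 2 * outdegreeSum xs xs
  length²≤ [] = z≤n
  length²≤ {x ∷ xs} (t ∷ ts) = begin
    suc l * suc l                    ≡⟨ lemma₁ l ⟩
    l * l + suc (2 * l)              ≤⟨ +-monoˡ-≤ (suc (2 * l)) (length²≤ ts) ⟩
    (l + 2 * S) + suc (2 * l)        ≡⟨ lemma₂ l S ⟩
    suc l + 2 * (l + S)              ≤⟨ +-monoʳ-≤ (suc l) (*-monoʳ-≤ 2 (≤-trans (outdegreeSum-∷ x xs t)
                                          (+-monoˡ-≤ _ (count-∷ (T? x) x xs)))) ⟩
    suc l + 2 * outdegreeSum (x ∷ xs) (x ∷ xs) ∎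
    where
    open ≤-Reasoning
    l = length xs
    S = outdegreeSum xs xs
    lemma₁ : ∀ l → suc l * suc l ≡ l * l + suc (2 * l)
    lemma₁ = solve-∀
    lemma₂ : ∀ l S → (l + 2 * S) + suc (2 * l) ≡ suc l + 2 * (l + S)
    lemma₂ = solve-∀

  outdegreeSum≤ : ∀ {d} xs ys → (∀ {x} → x ∈ xs → outdegree ys x ≤ d) →
    outdegreeSum xs ys ≤ length xs * d
  outdegreeSum≤ []       ys f = z≤n
  outdegreeSum≤ (x ∷ xs) ys f = +-mono-≤ (f (here refl)) (outdegreeSum≤ xs ys (f ∘ there))

  -- Averaging: l vertices carry at least l(l-1)/2 arcs, but at most l * d.
  tournament-length : ∀ {xs d} → AllPairs (λ x y → T x y ⊎ T y x) xs →
    (∀ {x} → x ∈ xs → outdegree xs x ≤ d) → length xs ≤ suc (2 * d)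
  tournament-length {[]} _ _ = z≤n
  tournament-length {xs@(_ ∷ _)} {d} t f = *-cancelˡ-≤ (length xs) (begin
    length xs * length xs                 ≤⟨ length²≤ t ⟩
    length xs + 2 * outdegreeSum xs xs    ≤⟨ +-monoʳ-≤ (length xs) (*-monoʳ-≤ 2 (outdegreeSum≤ xs xs f)) ⟩
    length xs + 2 * (length xs * d)       ≡⟨ lemma (length xs) d ⟩
    length xs * suc (2 * d)               ∎)
    where
    open ≤-Reasoning
    lemma : ∀ l d → l + 2 * (l * d) ≡ l * suc (2 * d)
    lemma = solve-∀

-- Window sizes and the recurrence.

red⊎blue : ∀ c → c ≡ red ⊎ c ≡ blue
red⊎blue true  = inj₁ refl
red⊎blue false = inj₂ refl

-- Chosen so that a window of size width (suc α) splits at its midpoint into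
-- two windows of size width α, after dropping the two values around the midpoint.
width : ℕ → ℕ
width zero    = 0
width (suc α) = 2 + (width α + width α)

-- A path of index `width α` thus has `2 ^ suc α` vertices.
2+width : ∀ α → 2 + width α ≡ 2 ^ suc α
2+width zero    = refl
2+width (suc α) = trans (lemma (width α)) (cong (2 *_) (2+width α))
  where
  lemma : ∀ w → 2 + (2 + (w + w)) ≡ 2 * (2 + w)
  lemma = solve-∀

1+8*9^k≤9^1+k : ∀ k → suc (8 * 9 ^ k) ≤ 9 ^ suc k
1+8*9^k≤9^1+k k = +-monoˡ-≤ (8 * 9 ^ k) (m^n>0 9 k)

-- Coloured paths and label windows.

module _ {N : ℕ} (χ : Coloring N) where

  -- Path c k a b: a copy of P²_{k+2} in colour c whose first two vertices are a and b.
  data Path (c : Bool) : ℕ → Fin N → Fin N → Set where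
    edge : ∀ {a b} → a <ᶠ b → χ a b ≡ c → Path c 0 a b
    cons : ∀ {k a b z} → a <ᶠ b → χ a b ≡ c → χ a z ≡ c → Path c k b z → Path c (suc k) a b

  path? : ∀ c k a b → Dec (Path c k a b)
  path? c zero a b = map′ (λ (p , q) → edge p q) (λ { (edge p q) → p , q })
    ((a <ᶠ? b) ×-dec (χ a b ≟ᵇ c))
  path? c (suc k) a b = map′ (λ (p , q , _ , r , s) → cons p q r s) (λ { (cons p q r s) → p , q , _ , r , s })
    ((a <ᶠ? b) ×-dec (χ a b ≟ᵇ c) ×-dec any? (λ z → (χ a z ≟ᵇ c) ×-dec path? c k b z))

  vertices : ∀ {c k a b} → Path c k a b → Fin (2 + k) → Fin N
  vertices {a = a}         _              zero       = a
  vertices {b = b}         (edge _ _)     (suc zero) = b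
  vertices                 (cons _ _ _ p) (suc i)    = vertices p i

  vertices-1 : ∀ {c k a b} (p : Path c k a b) → vertices p (suc zero) ≡ b
  vertices-1 (edge _ _)     = refl
  vertices-1 (cons _ _ _ p) = refl

  vertices-increasing : ∀ {c k a b} (p : Path c k a b) → StrictlyIncreasing (vertices p)
  vertices-increasing (edge a<b _)     zero    (suc zero) _ = a<b
  vertices-increasing (edge _ _)       (suc zero) (suc zero) (s≤s ())
  vertices-increasing (cons a<b _ _ p) zero    (suc zero)    _ = a<b
  vertices-increasing (cons a<b _ _ p) zero    (suc (suc j)) _ =
    <-trans a<b (vertices-increasing p zero (suc j) (s≤s z≤n))
  vertices-increasing (cons _ _ _ p)   (suc i) (suc j)    (s≤s i<j) = vertices-increasing p i j i<j

  vertices-colour : ∀ {c k a b} (p : Path c k a b) i j → toℕ i < toℕ j → toℕ j ∸ toℕ i ≤ 2 →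
    χ (vertices p i) (vertices p j) ≡ c
  vertices-colour (edge _ q)     zero    (suc zero)          _ _ = q
  vertices-colour (edge _ _)     (suc zero) (suc zero) (s≤s ()) _
  vertices-colour (cons _ q _ p) zero    (suc zero)          _ _ = q
  vertices-colour (cons {a = a} _ _ r p) zero (suc (suc zero)) _ _ = trans (cong (χ a) (vertices-1 p)) r
  vertices-colour (cons _ _ _ p) zero    (suc (suc (suc j))) _ (s≤s (s≤s ()))
  vertices-colour (cons _ _ _ p) (suc i) (suc j) (s≤s i<j) d = vertices-colour p i j i<j d

  path⇒copy : ∀ {c k n a b} → n ≤ 2 + k → Path c k a b → MonoCopy 2 n N χ c
  path⇒copy {n = n} n≤ p = vertices p ∘ ι ,
    (λ i j i<j → vertices-increasing p (ι i) (ι j) (subst₂ _<_ (ι-toℕ i) (ι-toℕ j) i<j)) ,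
    (λ i j i<j d → vertices-colour p (ι i) (ι j) (subst₂ _<_ (ι-toℕ i) (ι-toℕ j) i<j)
      (subst₂ (λ u v → v ∸ u ≤ 2) (ι-toℕ i) (ι-toℕ j) d))
    where
    ι : Fin n → Fin _
    ι i = inject≤ i n≤
    ι-toℕ : ∀ i → toℕ i ≡ toℕ (ι i)
    ι-toℕ i = sym (toℕ-inject≤ i n≤)

  -- Labels are never computed: `Path c k a b` says that the label of ab is at least k, as longer
  -- paths can be cut short. Labels of c-edges thus lie in [lo, lo + width α).
  record Window (c : Bool) (α lo : ℕ) (xs : List (Fin N)) : Set where
    constructor window
    field
      within : ∀ {a b} → a ∈ xs → b ∈ xs → a <ᶠ b → χ a b ≡ c →
        Path c lo a b × ¬ Path c (lo + width α) a b

  open Window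

  Window-⊆ : ∀ {c α lo xs ys} → ys ⊆ xs → Window c α lo xs → Window c α lo ys
  Window-⊆ s w .within a∈ b∈ = within w (s a∈) (s b∈)

  Sorted : List (Fin N) → Set
  Sorted = AllPairs _<ᶠ_

  -- Orients each c-edge by its label: left to right if it is below t, right to left otherwise.
  -- `Out` is the resulting arc relation.
  Above Below Out : Bool → ℕ → Fin N → Fin N → Set
  Above c t v y = v <ᶠ y × χ v y ≡ c × ¬ Path c t v y
  Below c t v y = y <ᶠ v × χ y v ≡ c × Path c t y v
  Out   c t v y = Above c t v y ⊎ Below c t v y

  above? : ∀ c t v y → Dec (Above c t v y)
  above? c t v y = (v <ᶠ? y) ×-dec (χ v y ≟ᵇ c) ×-dec ¬? (path? c t v y)

  below? : ∀ c t v y → Dec (Below c t v y)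
  below? c t v y = (y <ᶠ? v) ×-dec (χ y v ≟ᵇ c) ×-dec path? c t y v

  out? : ∀ c t v y → Dec (Out c t v y)
  out? c t v y = above? c t v y ⊎-dec below? c t v y

  out-total : ∀ {c} t {a b} → a <ᶠ b → χ a b ≡ c → Out c t a b ⊎ Out c t b a
  out-total {c} t {a} {b} a<b q with path? c t a b
  ... | yes p = inj₂ (inj₂ (a<b , q , p))
  ... | no ¬p = inj₁ (inj₁ (a<b , q , ¬p))

  -- The induction hypothesis one level down. At level zero, where no c-edges exist, it is trivial,
  -- so that `length-step` serves all four cases of the induction.
  Smaller : Bool → ℕ → List (Fin N) → ℕ → Set
  Smaller c zero    xs D = ⊤
  Smaller c (suc α) xs D = ∀ {lo ys} → ys ⊆ xs → Sorted ys → Window c α lo ys → length ys ≤ D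

  -- With w = `width α`, the window [lo, lo + 2 + 2w) is cut at t = lo + 1 + w; dropping t - 1 and t
  -- leaves [lo, lo + w) and [t + 1, t + 1 + w).
  midpoint : ℕ → ℕ → ℕ
  midpoint zero    lo = lo
  midpoint (suc α) lo = suc (lo + width α)

  module _ {c : Bool} {xs : List (Fin N)} (sorted : Sorted xs) where

    above-window : ∀ {α lo} v → Window c (suc α) lo xs →
      Window c α lo (filter (above? c (midpoint (suc α) lo) v) xs)
    above-window {α} {lo} v w .within a∈ b∈ a<b q
      with ∈-filter⁻ (above? c (midpoint (suc α) lo) v) {xs = xs} a∈
         | ∈-filter⁻ (above? c (midpoint (suc α) lo) v) {xs = xs} b∈
    ... | a∈xs , v<a , va , ¬p | b∈xs , _ , vb , _ =
      -- If ab had label at least t - 1, putting v in front would give va a label at least t.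
      proj₁ (within w a∈xs b∈xs a<b q) , λ p → ¬p (cons v<a va vb p)

    below-window : ∀ {α lo} v → Window c (suc α) lo xs →
      Window c α (suc (midpoint (suc α) lo)) (filter (below? c (midpoint (suc α) lo) v) xs)
    below-window {α} {lo} v w .within {a} {b} a∈ b∈ a<b q
      with ∈-filter⁻ (below? c (midpoint (suc α) lo) v) {xs = xs} a∈
         | ∈-filter⁻ (below? c (midpoint (suc α) lo) v) {xs = xs} b∈
    ... | a∈xs , _ , av , _ | b∈xs , b<v , bv , p =
      -- As bv has label at least t and av has colour c, putting a in front gives ab a label at
      -- least t + 1. The upper end is inherited.
      cons a<b q av p ,
      subst (λ k → ¬ Path c k a b) (lemma lo (width α)) (proj₂ (within w a∈xs b∈xs a<b q))
      where
      lemma : ∀ l w → l + (2 + (w + w)) ≡ suc (suc (l + w)) + w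
      lemma = solve-∀

    out-count : ∀ α {lo D v} → v ∈ xs → Window c α lo xs → Smaller c α xs D →
      count (out? c (midpoint α lo) v) xs ≤ 2 * D
    out-count zero {lo} {D} {v} v∈ w _ = ≤-trans (≤-reflexive (count-empty (out? c lo v) xs none)) z≤n
      where
      no-edge : ∀ {a b} → a ∈ xs → b ∈ xs → a <ᶠ b → ¬ χ a b ≡ c
      no-edge {a} {b} a∈ b∈ a<b q with within w a∈ b∈ a<b q
      ... | p , ¬p = ¬p (subst (λ k → Path c k a b) (sym (+-identityʳ lo)) p)
      none : ∀ {y} → y ∈ xs → ¬ Out c lo v y
      none y∈ (inj₁ (v<y , q , _)) = no-edge v∈ y∈ v<y q
      none y∈ (inj₂ (y<v , q , _)) = no-edge y∈ v∈ y<v q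
    out-count (suc α) {lo} {D} {v} v∈ w smaller = begin
      count (out? c t v) xs                              ≤⟨ count-⊎ (above? c t v) (below? c t v) xs ⟩
      count (above? c t v) xs + count (below? c t v) xs  ≤⟨ +-mono-≤
        (smaller (filter-⊆ (above? c t v) xs) (AllPairs.filter⁺ (above? c t v) sorted) (above-window v w))
        (smaller (filter-⊆ (below? c t v) xs) (AllPairs.filter⁺ (below? c t v) sorted) (below-window v w)) ⟩
      D + D                                              ≡⟨ cong (D +_) (sym (+-identityʳ D)) ⟩
      2 * D                                              ∎
      where
      open ≤-Reasoning
      t = midpoint (suc α) lo

  length-step : ∀ {α β lo lo′ xs D} → Sorted xs → Window red α lo xs → Window blue β lo′ xs →
    Smaller red α xs D → Smaller blue β xs D → length xs ≤ suc (8 * D)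
  length-step {α} {β} {lo} {lo′} {xs} {D} sorted wr wb sr sb =
    ≤-trans (tournament-length T? (AllPairs.map total sorted) small) (≤-reflexive (cong suc sum-of-classes))
    where
    t = midpoint α lo
    t′ = midpoint β lo′
    -- Each colour has its own threshold; the two orientations together form a tournament with
    -- out-degrees at most 4 D.
    T? = λ v y → out? red t v y ⊎-dec out? blue t′ v y
    total : ∀ {a b} → a <ᶠ b →
      (Out red t a b ⊎ Out blue t′ a b) ⊎ (Out red t b a ⊎ Out blue t′ b a)
    total {a} {b} a<b with red⊎blue (χ a b)
    ... | inj₁ q = Sum.map inj₁ inj₁ (out-total t a<b q)
    ... | inj₂ q = Sum.map inj₂ inj₂ (out-total t′ a<b q)
    small : ∀ {v} → v ∈ xs → count (T? v) xs ≤ 2 * D + 2 * D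
    small {v} v∈ = ≤-trans (count-⊎ (out? red t v) (out? blue t′ v) xs)
      (+-mono-≤ (out-count sorted α v∈ wr sr) (out-count sorted β v∈ wb sb))
    open ≡-Reasoning
    sum-of-classes : 2 * (2 * D + 2 * D) ≡ 8 * D
    sum-of-classes = begin
      2 * (2 * D + 2 * D)  ≡⟨ cong (2 *_) (sym (*-distribʳ-+ D 2 2)) ⟩
      2 * (4 * D)          ≡⟨ sym (*-assoc 2 4 D) ⟩
      8 * D                ∎

  -- Induction on α + β: a class of one colour halves the window of that colour and inherits the
  -- other window, so D is the preceding power of 9.
  length-bound : ∀ α β {lo lo′ xs} → Sorted xs → Window red α lo xs → Window blue β lo′ xs →
    length xs ≤ 9 ^ (α + β)
  -- No edges of either colour exist, so out-degrees vanish and at most one vertex remains.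
  length-bound zero zero s wr wb = length-step {D = 0} s wr wb tt tt
  length-bound (suc α) zero s wr wb = ≤-trans
    (length-step s wr wb
      (λ ys⊆ s′ w → length-bound α zero s′ w (Window-⊆ ys⊆ wb))
      tt)
    (1+8*9^k≤9^1+k (α + 0))
  length-bound zero (suc β) s wr wb = ≤-trans
    (length-step s wr wb
      tt
      (λ ys⊆ s′ w → length-bound zero β s′ (Window-⊆ ys⊆ wr) w))
    (1+8*9^k≤9^1+k β)
  length-bound (suc α) (suc β) s wr wb = ≤-trans
    (length-step s wr wb
      (λ ys⊆ s′ w → length-bound α (suc β) s′ w (Window-⊆ ys⊆ wb))
      (λ ys⊆ s′ w → ≤-trans (length-bound (suc α) β s′ (Window-⊆ ys⊆ wr) w)
             (≤-reflexive (cong (9 ^_) (sym (+-suc α β))))))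
    (1+8*9^k≤9^1+k (α + suc β))

-- An explicit N that arrows.

arrows : ∀ {n} α → n ≤ 2 ^ suc α → Arrows 2 n n (suc (9 ^ (α + α)))
arrows {n} α n≤ χ with longPath? red | longPath? blue
  where
  longPath? : ∀ c → Dec (∃ λ a → ∃ λ b → Path χ c (width α) a b)
  longPath? c = any? λ a → any? λ b → path? χ c (width α) a b
... | yes (_ , _ , p) | _ = inj₁ (path⇒copy χ (≤-trans n≤ (≤-reflexive (sym (2+width α)))) p)
... | no _ | yes (_ , _ , p) = inj₂ (path⇒copy χ (≤-trans n≤ (≤-reflexive (sym (2+width α)))) p)
... | no ¬r | no ¬b = contradiction
  (subst (_≤ 9 ^ (α + α)) (length-tabulate id)
    (length-bound χ α α (AllPairs.tabulate⁺-< id) (full ¬r) (full ¬b)))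
  (<-irrefl refl)
  where
  full : ∀ {c} → ¬ (∃ λ a → ∃ λ b → Path χ c (width α) a b) → Window χ c α 0 (allFin _)
  -- Every edge is itself a path of index 0, so the window starts at 0.
  full ¬p .Window.within _ _ a<b q = edge a<b q , λ p → ¬p (_ , _ , p)

-- Decidability of `Arrows` and existence of the minimum.

anyFunction? : ∀ {n N} {P : (Fin n → Fin N) → Set} → (∀ {f g} → f ≗ g → P f → P g) →
  Decidable P → Dec (∃ P)
anyFunction? resp P? = map′ (λ (i , p) → finToFun i , p)
  -- The decoded function agrees with `f` only pointwise, hence `resp`.
  (λ (f , p) → funToFin f , resp (λ i → sym (finToFun-funToFin f i)) p)
  (any? (λ i → P? (finToFun i)))

monoCopy? : ∀ ℓ n N χ c → Dec (MonoCopy ℓ n N χ c)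
monoCopy? ℓ n N χ c = anyFunction?
  (λ f≗g (inc , col) →
    (λ i j i<j → subst₂ _<_ (cong toℕ (f≗g i)) (cong toℕ (f≗g j)) (inc i j i<j)) ,
    (λ i j i<j d → trans (sym (cong₂ χ (f≗g i) (f≗g j))) (col i j i<j d)))
  (λ x →
    all? (λ i → all? λ j → (toℕ i <? toℕ j) →-dec (toℕ (x i) <? toℕ (x j))) ×-dec
    all? (λ i → all? λ j → (toℕ i <? toℕ j) →-dec ((toℕ j ∸ toℕ i ≤? ℓ) →-dec (χ (x i) (x j) ≟ᵇ c))))

monoCopy-resp : ∀ {ℓ n N c} {χ χ′ : Coloring N} → (∀ a b → χ a b ≡ χ′ a b) →
  MonoCopy ℓ n N χ c → MonoCopy ℓ n N χ′ c
monoCopy-resp χ≡ (x , inc , col) = x , inc , λ i j i<j d → trans (sym (χ≡ _ _)) (col i j i<j d)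

-- Colourings become subsets of the N * N ordered pairs, a finite search space for `anySubset?`.
decode : ∀ {N} → Subset (N * N) → Coloring N
decode p a b = lookup p (combine a b)

encode : ∀ {N} → Coloring N → Subset (N * N)
encode {N} χ = tabulate (uncurry χ ∘ remQuot N)

decode-encode : ∀ {N} (χ : Coloring N) a b → decode (encode χ) a b ≡ χ a b
decode-encode {N} χ a b =
  trans (lookup∘tabulate _ (combine a b)) (cong (uncurry χ) (remQuot-combine a b))

-- This lets `least` exhibit the Ramsey number constructively. Searching encoded colourings suffices
-- because copies respect pointwise equality.
arrows? : ∀ ℓ s n N → Dec (Arrows ℓ s n N)
arrows? ℓ s n N = map′
  (λ none χ → Sum.map (monoCopy-resp (decode-encode χ)) (monoCopy-resp (decode-encode χ))
    (decidable-stable (good? (decode (encode χ))) λ bad → none (encode χ , bad)))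
  (λ arr (p , bad) → bad (arr (decode p)))
  (¬? (anySubset? λ p → ¬? (good? (decode p))))
  where
  good? : ∀ χ → Dec (MonoCopy ℓ s N χ red ⊎ MonoCopy ℓ n N χ blue)
  good? χ = monoCopy? ℓ s N χ red ⊎-dec monoCopy? ℓ n N χ blue

least : ∀ {P : ℕ → Set} → Decidable P → ∀ {m} → P m → ∃ λ k → k ≤ m × P k × (∀ j → j < k → ¬ P j)
least P? {m} pm with P? 0
... | yes p0 = 0 , z≤n , p0 , λ _ ()
least P? {zero}  pm | no ¬p0 = contradiction pm ¬p0
least P? {suc m} pm | no ¬p0 with least (P? ∘ suc) pm
... | k , k≤m , pk , below = suc k , s≤s k≤m , pk ,
  λ { zero _ → ¬p0 ; (suc j) (s≤s j<k) → below j j<k }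

-- Numerical estimates and the final bound.

binary-length : ∀ n → ∃ λ α → 2 ^ α ≤ suc n × suc n ≤ 2 ^ suc α
binary-length zero = 0 , ≤-refl , s≤s z≤n
binary-length (suc n) with binary-length n
... | α , lower , upper with suc (suc n) ≤? 2 ^ suc α
...   | yes p = α , m≤n⇒m≤1+n lower , p
...   | no ¬p = suc α , <⇒≤ (≰⇒> ¬p) , ≤-trans (s≤s upper) (^-monoʳ-< 2 ≤-refl (n<1+n (suc α)))

-- Since 81 ≤ 128 = 2 ^ 7, the power of 9 is at most n ^ 7; a further factor n ≥ 2 absorbs the 1.
1+9^2α≤n^8 : ∀ {n} α → 2 ≤ n → 2 ^ α ≤ n → suc (9 ^ (α + α)) ≤ n ^ 8
1+9^2α≤n^8 {n} α 2≤n 2^α≤n = begin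
  suc (9 ^ (α + α))  ≤⟨ +-mono-≤ (≤-trans (m^n>0 9 (α + α)) 9^2α≤n^7) 9^2α≤n^7 ⟩
  n ^ 7 + n ^ 7      ≡⟨ cong (n ^ 7 +_) (sym (+-identityʳ (n ^ 7))) ⟩
  2 * n ^ 7          ≤⟨ *-monoˡ-≤ (n ^ 7) 2≤n ⟩
  n ^ 8              ∎
  where
  open ≤-Reasoning
  9^2α≤n^7 : 9 ^ (α + α) ≤ n ^ 7
  9^2α≤n^7 = begin
    9 ^ (α + α)    ≡⟨ cong (λ k → 9 ^ (α + k)) (sym (+-identityʳ α)) ⟩
    9 ^ (2 * α)    ≡⟨ sym (^-*-assoc 9 2 α) ⟩
    81 ^ α         ≤⟨ ^-monoˡ-≤ α (m≤m+n 81 47) ⟩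
    (2 ^ 7) ^ α    ≡⟨ ^-*-assoc 2 7 α ⟩
    2 ^ (7 * α)    ≡⟨ cong (2 ^_) (*-comm 7 α) ⟩
    2 ^ (α * 7)    ≡⟨ sym (^-*-assoc 2 α 7) ⟩
    (2 ^ α) ^ 7    ≤⟨ ^-monoˡ-≤ 7 2^α≤n ⟩
    n ^ 7          ∎

ramsey≤n^8 : ∀ {n} → 2 ≤ n → ∃ λ r → IsOrderedRamseyNumber 2 n n r × r ≤ n ^ 8
ramsey≤n^8 {n@(suc n-1)} 2≤n with binary-length n-1
-- `upper` provides long enough paths; `lower` turns 2 ^ α into n in the estimate.
... | α , lower , upper with least (arrows? 2 n n) (arrows α upper)
...   | r , r≤ , arr , minimal = r , (arr , minimal) , ≤-trans r≤ (1+9^2α≤n^8 α 2≤n lower)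

-- Taking e-th powers encodes the rational exponent f / e: the bound reads r < 2^(1/e) n^(f/e). The
-- factor 2 makes it strict.
r^e<2n^f : ∀ {n r} d e f → 0 < n → d * e ≤ f → r ≤ n ^ d → r ^ e < 2 * n ^ f
r^e<2n^f {n@(suc _)} {r} d e f _ de≤f r≤ = begin-strict
  r ^ e           ≤⟨ ^-monoˡ-≤ e r≤ ⟩
  (n ^ d) ^ e     ≡⟨ ^-*-assoc n d e ⟩
  n ^ (d * e)     ≤⟨ ^-monoʳ-≤ n de≤f ⟩
  n ^ f           <⟨ m<m+n (n ^ f) (≤-trans (m^n>0 n f) (m≤m+n _ 0)) ⟩
  2 * n ^ f       ∎
  where open ≤-Reasoning

theorem1 : Σ ℕ λ C → 0 < C × ((n : ℕ) → 2 ≤ n →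
    Σ ℕ λ r → IsOrderedRamseyNumber 2 n n r × r ^ 1000 < C * n ^ 19487)
theorem1 = 2 , s≤s z≤n , λ n 2≤n →
  let (r , ramsey , r≤n^8) = ramsey≤n^8 2≤n
  -- 19.487 is 19487 / 1000, and 8 * 1000 ≤ 19487 is checked by evaluation.
  in r , ramsey , r^e<2n^f 8 1000 19487 (<⇒≤ 2≤n) (≤ᵇ⇒≤ 8000 19487 tt) r≤n^8
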